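{- Safe belief cannot be defined in terms of knowledge and conditional belief: for every agent $i \in G$, the safe belief operator $B_i^{+}$ is not definable in the language $\mathcal{L}(K,B^c)$ over the class of all epistemic plausibility models.
   Context: Fix a non-empty set $G$ of agents and a countably infinite set $Prop$ of proposition letters. Models. An epistemic plausibility model is a structure $\mathbb{M} = \langle W, \{\sim_i\}_{i \in G}, \{\leq_{i,w}\}_{i \in G}^{w \in W}, V\rangle$ where $W$ is a non-empty set of states, each $\sim_i \subseteq W\times W$ is an equivalence relation, each $\leq_{i,w} \subseteq W \times W$ is a well-founded pre-order, and $V : Prop \to \wp(W)$. For $X \subseteq W$, $\mathrm{Min}_{\leq_{i,w}}(X) := \{x \in X \mid \forall y \in X: y \leq_{i,w} x \Rightarrow x \leq_{i,w} y\}$. A well-founded pre-order is a reflexive transitive relation (not necessarily total) such that $\mathrm{Min}_{\leq_{i,w}}(X) \neq \emptyset$ for every non-empty $X \subseteq W$. Write $[w]_{\sim_i} := \{v \in W \mid w \sim_i v\}$. Language and semantics. $\mathcal{L}(K,B^c)$ is built from proposition letters $p\in Prop$ using $\neg$, $\wedge$, the unary operators $K_i$ (knowledge) and the binary operators $B_i^\alpha\varphi$ (conditional belief; $\alpha,\varphi$ both formulas of the language), $i\in G$. Proposition letters (via $V$) and Booleans are interpreted as usual; $[\![\alpha]\!]^{\mathbb{M}} := \{w \in W \mid \mathbb{M},w\models\alpha\}$; $\mathbb{M},w \models K_i\varphi$ iff $\forall v \in [w]_{\sim_i}: \mathbb{M},v\models\varphi$; $\mathbb{M},w \models B_i^\alpha\varphi$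 iff $\forall v \in \mathrm{Min}_{\leq_{i,w}}([\![\alpha]\!]^{\mathbb{M}} \cap [w]_{\sim_i}): \mathbb{M},v\models\varphi$; and safe belief is interpreted by $\mathbb{M},w \models B_i^+\varphi$ iff $\forall v \in [w]_{\sim_i}: v \leq_{i,w} w \Rightarrow \mathbb{M},v\models\varphi$. Definability. The operator $B_i^+$ is definable in $\mathcal{L}(K,B^c)$ if for every $\beta\in\mathcal{L}(K,B^c)$ there is a formula $\varphi\in\mathcal{L}(K,B^c)$ such that $\mathbb{M},w\models B_i^+\beta\leftrightarrow\varphi$ for all epistemic plausibility models $\mathbb{M}$ and all states $w$ of $\mathbb{M}$. -}

module Defs where

open import Level using (0ℓ)
open import Data.Product using (_×_; ∃-syntax)
open import Function.Bundles using (_⇔_)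
open import Relation.Binary.Core using (Rel)
open import Relation.Binary.PropositionalEquality using (_≡_)
open import Relation.Binary.Structures using (IsEquivalence; IsPreorder)
open import Relation.Nullary using (¬_)
open import Relation.Unary using (Pred; Empty; U; _∈_; _∩_)

-- X ≠ ∅, read literally as a negation.  With Satisfiable in its place,
-- well-foundedness below would ask for an algorithm producing minimal elements
-- of arbitrary predicates, which already fails constructively for a two-element
-- chain.  Under excluded middle the two readings agree.
NonEmpty : {A : Set} → Pred A 0ℓ → Set
NonEmpty X = ¬ Empty X

module _ {W : Set} where

  Min : Rel W 0ℓ → Pred W 0ℓ → Pred W 0ℓ
  Min _≤_ X x = x ∈ X × (∀ y → y ∈ X → y ≤ x → x ≤ y)

  -- This is not the accessibility-based WellFounded of the standard library:
  -- the relation is reflexive, and minimality is taken up to equi-plausibility.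
  record IsWellFoundedPreorder (_≤_ : Rel W 0ℓ) : Set₁ where
    field
      isPreorder  : IsPreorder _≡_ _≤_
      wellFounded : (X : Pred W 0ℓ) → NonEmpty X → NonEmpty (Min _≤_ X)

module _ (G Letter : Set) where

  record Model : Set₁ where
    field
      W             : Set
      W-nonEmpty    : NonEmpty (U {A = W})
      _∼⟨_⟩_        : W → G → W → Set
      ∼-equivalence : ∀ i → IsEquivalence (_∼⟨ i ⟩_)
      -- u ≤⟨ i , w ⟩ v is  u ≤_{i,w} v.
      _≤⟨_,_⟩_      : W → G → W → W → Set
      ≤-wfPreorder  : ∀ i w → IsWellFoundedPreorder (_≤⟨ i , w ⟩_)
      V             : Letter → Pred W 0ℓ

    [_]∼⟨_⟩ : W → G → Pred W 0ℓ
    [ w ]∼⟨ i ⟩ v = w ∼⟨ i ⟩ v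

  data Formula : Set where
    atom : Letter → Formula
    ~_   : Formula → Formula
    _&_  : Formula → Formula → Formula
    K    : G → Formula → Formula
    -- B i α φ is  B_i^α φ.
    B    : G → Formula → Formula → Formula

module _ {G Letter : Set} where

  infix 4 _,_⊨_ _,_⊨B⁺⟨_⟩_

  mutual
    _,_⊨_ : (M : Model G Letter) → Model.W M → Formula G Letter → Set
    M , w ⊨ atom p  = w ∈ Model.V M p
    M , w ⊨ (~ φ)   = ¬ (M , w ⊨ φ)
    M , w ⊨ (φ & ψ) = (M , w ⊨ φ) × (M , w ⊨ ψ)
    M , w ⊨ K i φ   = ∀ v → v ∈ [ w ]∼⟨ i ⟩ → M , v ⊨ φ
      where open Model M
    M , w ⊨ B i α φ =
      ∀ v → v ∈ Min (_≤⟨ i , w ⟩_) (⟦ α ⟧ M ∩ [ w ]∼⟨ i ⟩) → M , v ⊨ φ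
      where open Model M

    ⟦_⟧ : Formula G Letter → (M : Model G Letter) → Pred (Model.W M) 0ℓ
    ⟦ φ ⟧ M w = M , w ⊨ φ

  -- Safe belief is not an operator of Formula; this is the truth clause of
  -- B_i^+ φ for φ in the language.
  _,_⊨B⁺⟨_⟩_ : (M : Model G Letter) → Model.W M → G → Formula G Letter → Set
  M , w ⊨B⁺⟨ i ⟩ φ = ∀ v → v ∈ [ w ]∼⟨ i ⟩ → v ≤⟨ i , w ⟩ w → M , v ⊨ φ
    where open Model M

SafeBeliefDefinable : (G Letter : Set) → G → Set₁
SafeBeliefDefinable G Letter i =
  (β : Formula G Letter) → ∃[ φ ]
    ((M : Model G Letter) (w : Model.W M) → (M , w ⊨B⁺⟨ i ⟩ β) ⇔ (M , w ⊨ φ))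

{-# OPTIONS --safe #-}

-- Conditional belief sees a plausibility order only through its minimal
-- elements, and a symmetric order makes every element of every set minimal.  So
-- incomparable states and equiplausible states satisfy the same formulas, whereas
-- safe belief tells them apart: let two states be mutually accessible and let p
-- hold in just one of them; there p is safely believed if the states are
-- incomparable, but not if they are equiplausible.

module Submission where

open import Level using (0ℓ)
open import Data.Bool using (Bool; true; false)
open import Data.Nat using (ℕ)
open import Data.Product using (_,_)
open import Data.Unit using (tt)
open import Function.Bundles using (_⤖_; module Bijection; module Equivalence)
open import Relation.Binary.Construct.Always using (Always)
  renaming (isEquivalence to Always-isEquivalence)
open import Relation.Binary.Core using (Rel)
open import Relation.Binary.Definitions using (Symmetric)
open import Relation.Binary.PropositionalEquality using (_≡_; isEquivalence)
open import Relation.Binary.Structures using (IsEquivalence)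
open import Relation.Nullary using (¬_)
open import Relation.Unary using (Pred; U; _⊆_)
open import Defs

module _ {W : Set} {_≤_ : Rel W 0ℓ} where

  symmetric⇒⊆Min : Symmetric _≤_ → (X : Pred W 0ℓ) → X ⊆ Min _≤_ X
  symmetric⇒⊆Min sym X x∈X = x∈X , λ _ _ → sym

  isEquivalence⇒isWellFoundedPreorder : IsEquivalence _≤_ → IsWellFoundedPreorder _≤_
  isEquivalence⇒isWellFoundedPreorder eq = record
    { isPreorder = record
      { isEquivalence = isEquivalence
      ; reflexive     = IsEquivalence.reflexive eq
      ; trans         = IsEquivalence.trans eq
      }
    ; wellFounded = λ X X≠∅ Min≡∅ → X≠∅ λ x x∈X →
        Min≡∅ x (symmetric⇒⊆Min (IsEquivalence.sym eq) X x∈X)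
    }

module _ {G Letter : Set} where

  -- Everything but the order is fixed, uniformly in agents, letters and states, so two such models
  -- can differ only in plausibility.
  twoStates : {_≤_ : Rel Bool 0ℓ} → IsEquivalence _≤_ → Model G Letter
  twoStates {_≤_} eq = record
    { W             = Bool
    ; W-nonEmpty    = λ empty → empty true tt
    ; _∼⟨_⟩_        = λ w _ v → Always w v
    ; ∼-equivalence = λ _ → Always-isEquivalence Bool 0ℓ
    ; _≤⟨_,_⟩_      = λ u _ _ v → u ≤ v
    ; ≤-wfPreorder  = λ _ _ → isEquivalence⇒isWellFoundedPreorder eq
    ; V             = λ _ w → w ≡ true
    }

  -- Both orders are arbitrary because the induction swaps them at contravariant positions: under
  -- `~` and in the condition `α` of `B`.
  ⊨-twoStates : ∀ {_≤₁_ _≤₂_ : Rel Bool 0ℓ}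
                (eq₁ : IsEquivalence _≤₁_) (eq₂ : IsEquivalence _≤₂_)
                (φ : Formula G Letter) {w} →
                twoStates eq₁ , w ⊨ φ → twoStates eq₂ , w ⊨ φ
  ⊨-twoStates eq₁ eq₂ (atom p)  w⊨p         = w⊨p
  ⊨-twoStates eq₁ eq₂ (~ φ)     w⊭φ         = λ w⊨φ → w⊭φ (⊨-twoStates eq₂ eq₁ φ w⊨φ)
  ⊨-twoStates eq₁ eq₂ (φ & ψ)   (w⊨φ , w⊨ψ) = ⊨-twoStates eq₁ eq₂ φ w⊨φ , ⊨-twoStates eq₁ eq₂ ψ w⊨ψ
  ⊨-twoStates eq₁ eq₂ (K i φ)   w⊨Kφ        = λ v w∼v → ⊨-twoStates eq₁ eq₂ φ (w⊨Kφ v w∼v)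
  -- Minimality for the second order is discarded; symmetry of the first supplies its own from
  -- membership alone.
  ⊨-twoStates eq₁ eq₂ (B i α φ) w⊨Bφ        = λ v ((v⊨α , w∼v) , _) →
    ⊨-twoStates eq₁ eq₂ φ (w⊨Bφ v
      (symmetric⇒⊆Min (IsEquivalence.sym eq₁) _ (⊨-twoStates eq₂ eq₁ α v⊨α , w∼v)))

  incomparable equiplausible : Model G Letter
  incomparable  = twoStates isEquivalence
  equiplausible = twoStates (Always-isEquivalence Bool 0ℓ)

  safeBelief-undefinable : Letter → (i : G) → ¬ SafeBeliefDefinable G Letter i
  safeBelief-undefinable p i definable with φ , B⁺p⇔φ ← definable (atom p) =
    -- Here `false` is accessible from `true` and as plausible, so safe belief in `p` at `true`
    -- would force `p` at `false`.
    false≢true (Equivalence.from (B⁺p⇔φ equiplausible true) φ-equiplausible false _ _)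
    where
    false≢true : ¬ false ≡ true
    false≢true ()

    φ-equiplausible : equiplausible , true ⊨ φ
    φ-equiplausible = ⊨-twoStates isEquivalence (Always-isEquivalence Bool 0ℓ) φ
      -- The order is equality, so `v ≤ true` and the truth of `p` at `v` are the same proposition.
      (Equivalence.to (B⁺p⇔φ incomparable true) λ _ _ v≡true → v≡true)

theorem15 : (G Letter : Set) → NonEmpty (U {A = G}) → Letter ⤖ ℕ →
            (i : G) → ¬ SafeBeliefDefinable G Letter i
theorem15 G Letter _ Letter⤖ℕ = safeBelief-undefinable (Bijection.to⁻ Letter⤖ℕ 0)
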